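{- Let $G$ be a finite simple graph. Then either (i) $c_2(G) = \mathrm{mr}(G,\mathbb{F}_2)$, or (ii) $c_2(G) = \mathrm{mr}(G,\mathbb{F}_2)+1$, in which case $\mathrm{mr}(G,\mathbb{F}_2)$ is even.
   Context: All graphs are finite and simple. A subgraph complementation system for a graph $G=(V,E)$ is a finite collection (family) $\mathscr{C}$ of subsets of $V$ such that, for any two distinct vertices $u,v\in V$, $uv\in E$ if and only if $u$ and $v$ appear together in an odd number of sets in $\mathscr{C}$. The subgraph complementation number $c_2(G)$ is the minimum cardinality of a subgraph complementation system for $G$. A symmetric matrix over a field $\mathbb{F}$ with rows and columns indexed by $V$ fits $G$ if, for distinct $u,v$, its $(u,v)$ entry is nonzero if and only if $uv\in E$ (the diagonal is arbitrary). $\mathrm{mr}(G,\mathbb{F})$ is the minimum rank over $\mathbb{F}$ of a symmetric matrix over $\mathbb{F}$ which fits $G$. -}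

module Defs where

open import Algebra.Bundles using (CommutativeRing)
open import Data.Bool.Properties using (xor-∧-commutativeRing)
open import Data.Fin using (Fin)
open import Data.Fin.Subset using (Subset; _∈_)
open import Data.Fin.Subset.Properties using (_∈?_)
open import Data.Nat using (ℕ; _≤_)
open import Data.Nat.Divisibility using (_∣_)
open import Data.Nat.Properties using (≤-antisym)
open import Data.Product using (∃; _×_; _,_)
open import Data.Vec using (Vec; count)
open import Data.Vec.Functional using (Vector)
open import Function.Bundles using (_⇔_)
open import Level using (Level; 0ℓ; _⊔_)
open import Relation.Binary using (Rel; Symmetric; Irreflexive; Decidable)
open import Relation.Binary.PropositionalEquality using (_≡_; _≢_)
open import Relation.Nullary using (¬_)
open import Relation.Nullary.Decidable using (_×-dec_)
open import Relation.Unary using (Pred)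

private
  variable
    p : Level

-- Decidability of adjacency is automatic classically; constructively it is
-- part of what it means for the graph to be finite.
record Graph (n : ℕ) : Set₁ where
  field
    _~_      : Rel (Fin n) 0ℓ
    ~-sym    : Symmetric _~_
    ~-irrefl : Irreflexive _≡_ _~_
    _~?_     : Decidable _~_

Even Odd : ℕ → Set
Even k = 2 ∣ k
Odd k = ¬ Even k

IsMinimum IsMaximum : Pred ℕ p → Pred ℕ p
IsMinimum P m = P m × (∀ k → P k → m ≤ k)
IsMaximum P m = P m × (∀ k → P k → k ≤ m)

-- "m is the minimum of P" therefore determines m, so numbers such as c₂(G)
-- may be introduced by this relation.
minimum-unique : {P : Pred ℕ p} {m m′ : ℕ} → IsMinimum P m → IsMinimum P m′ → m ≡ m′
minimum-unique (Pm , m≤) (Pm′ , m′≤) = ≤-antisym (m≤ _ Pm′) (m′≤ _ Pm)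

-- A family of k vertex subsets; as a family it may list a subset repeatedly.
IsSubgraphComplementationSystem : ∀ {n k} → Graph n → Vec (Subset n) k → Set
IsSubgraphComplementationSystem G 𝒞 =
  ∀ u v → u ≢ v →
    u ~ v ⇔ Odd (count (λ S → (u ∈? S) ×-dec (v ∈? S)) 𝒞)
  where open Graph G

-- k is c₂(G).
IsSubgraphComplementationNumber : ∀ {n} → Graph n → ℕ → Set
IsSubgraphComplementationNumber {n} G =
  IsMinimum (λ k → ∃ λ (𝒞 : Vec (Subset n) k) → IsSubgraphComplementationSystem G 𝒞)

-- The inverses of a field enter none of the definitions below, so the
-- parameter is a commutative ring; the notions are meant for fields.
module LinearAlgebra {c ℓ} (𝔽 : CommutativeRing c ℓ) where
  open CommutativeRing 𝔽
  open import Algebra.Properties.Semiring.Sum semiring using (sum)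

  Matrix : ℕ → ℕ → Set c
  Matrix m n = Fin m → Fin n → Carrier

  column : ∀ {m n} → Matrix m n → Fin n → Vector Carrier m
  column A j i = A i j

  LinearlyIndependent : ∀ {m k} → (Fin k → Vector Carrier m) → Set (c ⊔ ℓ)
  LinearlyIndependent {m} {k} x =
    ∀ (a : Vector Carrier k) →
      (∀ i → sum (λ j → a j * x j i) ≈ 0#) → ∀ j → a j ≈ 0#

  -- The rank is the maximum number of linearly independent columns.  The
  -- selection s need not be assumed injective: over a field, independence
  -- of the selected family already excludes repetitions.
  IsRank : ∀ {m n} → Matrix m n → ℕ → Set (c ⊔ ℓ)
  IsRank {m} {n} A =
    IsMaximum (λ k → ∃ λ (s : Fin k → Fin n) → LinearlyIndependent (λ j → column A (s j)))

  SymmetricMatrix : ∀ {n} → Matrix n n → Set ℓ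
  SymmetricMatrix A = ∀ i j → A i j ≈ A j i

  Fits : ∀ {n} → Matrix n n → Graph n → Set ℓ
  Fits A G = ∀ u v → u ≢ v → (¬ A u v ≈ 0#) ⇔ u ~ v
    where open Graph G

-- r is mr(G, 𝔽).
IsMinimumRank : ∀ {c ℓ n} → Graph n → CommutativeRing c ℓ → ℕ → Set (c ⊔ ℓ)
IsMinimumRank {n = n} G 𝔽 =
  IsMinimum (λ r → ∃ λ (A : Matrix n n) → SymmetricMatrix A × Fits A G × IsRank A r)
  where open LinearAlgebra 𝔽

-- Bool with addition xor and multiplication ∧.
𝔽₂ : CommutativeRing 0ℓ 0ℓ
𝔽₂ = xor-∧-commutativeRing

{-# OPTIONS --safe #-}
-- A system 𝒞 with incidence matrix M fits G exactly when M Mᵀ does, so c₂(G)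
-- is the least number of columns of an M such that M Mᵀ fits G.  Eliminating
-- with symmetric pivots writes a symmetric A of rank r over 𝔽₂ as a sum of
-- squares w wᵀ and hyperbolic terms x yᵀ + y xᵀ, one per unit of rank and one
-- per two units of rank respectively.  Since
--   w wᵀ + x yᵀ + y xᵀ = (w+x)(w+x)ᵀ + (w+y)(w+y)ᵀ + (w+x+y)(w+x+y)ᵀ,
-- a single square absorbs all hyperbolic terms without any loss; only when A
-- has zero diagonal is there no square, and then r is even and the square of
-- the zero vector has to be spent.
module Submission where

open import Defs
open import Data.Bool using (Bool; true; false; not; _∧_; _xor_; _≟_)
open import Data.Bool.Properties
  using (¬-not; not-involutive; xor-identityʳ; xor-same; ∧-zeroʳ; ∧-identityʳ; ∧-comm; ∧-distribʳ-xor)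
open import Data.Bool.Solver using (module xor-∧-Solver)
open import Data.Fin using (Fin; zero; suc; combine; finToFun; funToFin)
import Data.Fin as Fin
open import Data.Fin.Properties
  using (any?; all?; injective⇒≤; funToFin-finToFin; finToFun-funToFin; 2↔Bool)
open import Data.Fin.Subset using (Subset)
open import Data.Fin.Subset.Properties using (_∈?_; anySubset?)
open import Data.Nat using (ℕ; zero; suc; _+_; _*_; _^_; _≤_; _<_; z≤n; s≤s; s≤s⁻¹; z<s; s<s)
import Data.Nat as ℕ
open import Data.Nat.Divisibility using (_∣_; divides-refl; _∣0; ∣m∣n⇒∣m+n; ∣-refl)
open import Data.Nat.Properties
  using (≤-trans; ≤-antisym; <-trans; n<1+n; ≮⇒≥; <⇒≱; ^-monoʳ-<; m≤n⇒m<n∨m≡n)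
open import Data.Product using (∃; _×_; _,_; proj₁; uncurry)
open import Data.Sum using (_⊎_; inj₁; inj₂; [_,_]′)
open import Data.Vec using (Vec; []; _∷_; lookup; tabulate; count)
open import Data.Vec.Functional using (Vector; head; tail)
import Data.Vec.Functional as Vector
open import Level using (0ℓ)
open import Data.Vec.Properties using (lookup∘tabulate)
open import Function using (_∘_)
open import Function.Bundles using (_⇔_; mk⇔; module Equivalence; module Inverse)
open import Function.Construct.Composition using (_⇔-∘_)
open import Function.Construct.Symmetry using (⇔-sym)
open import Relation.Binary.PropositionalEquality
  using (_≡_; _≗_; refl; sym; trans; cong; cong₂; subst; module ≡-Reasoning)
open import Relation.Nullary using (¬_; Dec; yes; no; does; contradiction)
open import Relation.Nullary.Decidable
  using (map′; _×-dec_; _→-dec_; ¬?; does-⇔; decidable-stable; dec-true; dec-false)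
open import Relation.Unary using (Pred; Decidable)
open import Algebra.Bundles using (CommutativeRing)
open import Algebra.Properties.Semiring.Sum (CommutativeRing.semiring 𝔽₂)
  using (sum; sum-cong-≗; ∑-distrib-+; ∑-comm; *-distribˡ-sum)

open LinearAlgebra 𝔽₂
open ≡-Reasoning

private
  variable
    k m n r : ℕ

-- Independence and rank over 𝔽₂

sum-zero : {f : Vector Bool n} → (∀ i → f i ≡ false) → sum f ≡ false
sum-zero {zero}  f≡0 = refl
sum-zero {suc n} f≡0 = cong₂ _xor_ (f≡0 zero) (sum-zero (f≡0 ∘ suc))

xor≡false⇒≡ : ∀ a b → a xor b ≡ false → a ≡ b
xor≡false⇒≡ false false _ = refl
xor≡false⇒≡ true  true  _ = refl

sum-∧-distribʳ-xor : (xs f g : Vector Bool n) →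
  sum (λ j → (f j xor g j) ∧ xs j) ≡ sum (λ j → f j ∧ xs j) xor sum (λ j → g j ∧ xs j)
sum-∧-distribʳ-xor xs f g = trans
  (sum-cong-≗ (λ j → ∧-distribʳ-xor (xs j) (f j) (g j)))
  (∑-distrib-+ (λ j → f j ∧ xs j) (λ j → g j ∧ xs j))

funToFin-cong : {f g : Fin m → Fin n} → f ≗ g → funToFin f ≡ funToFin g
funToFin-cong {zero}  f≗g = refl
funToFin-cong {suc m} f≗g = cong₂ combine (f≗g zero) (funToFin-cong (f≗g ∘ suc))

-- Distinct coefficient vectors give distinct combinations, so 2ᵏ ≤ 2ᵐ.
independent⇒≤ : (x : Fin k → Vector Bool m) → LinearlyIndependent x → k ≤ m
independent⇒≤ {k} {m} x indep =
  ≮⇒≥ (λ m<k → <⇒≱ (^-monoʳ-< 2 (s<s z<s) m<k) (injective⇒≤ {f = encode} encode-injective))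
  where
  open Inverse 2↔Bool using (to; from; strictlyInverseˡ; strictlyInverseʳ)

  coefficients : Fin (2 ^ k) → Vector Bool k
  coefficients c j = to (finToFun {2} {k} c j)

  combination : Vector Bool k → Vector Bool m
  combination a i = sum (λ j → a j ∧ x j i)

  encode : Fin (2 ^ k) → Fin (2 ^ m)
  encode c = funToFin (from ∘ combination (coefficients c))

  combination-injective : ∀ a b → combination a ≗ combination b → a ≗ b
  -- Over 𝔽₂ subtraction is `xor`, so two equal combinations give a relation with coefficients
  -- `a j xor b j`.
  combination-injective a b eq j = xor≡false⇒≡ (a j) (b j) (indep (λ j → a j xor b j) (λ i → begin
    sum (λ j → (a j xor b j) ∧ x j i)   ≡⟨ sum-∧-distribʳ-xor (λ j → x j i) a b ⟩
    combination a i xor combination b i ≡⟨ cong (_xor combination b i) (eq i) ⟩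
    combination b i xor combination b i ≡⟨ xor-same (combination b i) ⟩
    false                               ∎) j)

  decode : ∀ c → to ∘ finToFun {2} {m} (encode c) ≗ combination (coefficients c)
  decode c i = trans (cong to (finToFun-funToFin (from ∘ combination (coefficients c)) i)) (strictlyInverseˡ _)

  encode-injective : ∀ {c d} → encode c ≡ encode d → c ≡ d
  encode-injective {c} {d} eq = begin
    c                                ≡⟨ funToFin-finToFin {k} c ⟨
    funToFin (finToFun {2} {k} c)    ≡⟨ funToFin-cong (λ j → begin
      finToFun {2} {k} c j             ≡⟨ strictlyInverseʳ _ ⟨
      from (coefficients c j)          ≡⟨ cong from (combination-injective _ _ (λ i → begin
        combination (coefficients c) i   ≡⟨ decode c i ⟨
        to (finToFun (encode c) i)       ≡⟨ cong (λ e → to (finToFun {2} {m} e i)) eq ⟩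
        to (finToFun (encode d) i)       ≡⟨ decode d i ⟩
        combination (coefficients d) i   ∎) j) ⟩
      from (coefficients d j)          ≡⟨ strictlyInverseʳ _ ⟩
      finToFun {2} {k} d j             ∎) ⟩
    funToFin (finToFun {2} {k} d)    ≡⟨ funToFin-finToFin {k} d ⟩
    d                                ∎

IndependentColumns : Matrix m n → ℕ → Set
IndependentColumns {n = n} A k = ∃ λ (s : Fin k → Fin n) → LinearlyIndependent (λ j → column A (s j))

independentColumns-0 : (A : Matrix m n) → IndependentColumns A 0
independentColumns-0 A = (λ ()) , (λ _ _ ())

independentColumns-resp : {A B : Matrix m n} → (∀ u v → A u v ≡ B u v) →
  IndependentColumns A k → IndependentColumns B k
independentColumns-resp A≡B (s , indep) = s , λ a comb → indep a λ i →
  trans (sum-cong-≗ (λ j → cong (a j ∧_) (A≡B i (s j)))) (comb i)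

isRank-resp : {A B : Matrix m n} → (∀ u v → A u v ≡ B u v) → IsRank A r → IsRank B r
isRank-resp A≡B (cols , max) =
  independentColumns-resp A≡B cols ,
  λ k → max k ∘ independentColumns-resp (λ u v → sym (A≡B u v))

isRank-unique : {A : Matrix m n} {r r′ : ℕ} → IsRank A r → IsRank A r′ → r ≡ r′
isRank-unique (cols , max) (cols′ , max′) = ≤-antisym (max′ _ cols) (max _ cols′)

-- Certifies rank at most `r` by factoring the linear map through 𝔽₂ʳ.
Factorization : Matrix m n → ℕ → Set
Factorization {m} {n} A r = ∃ λ (B : Matrix m r) → ∃ λ (C : Matrix r n) →
  ∀ u v → A u v ≡ sum (λ l → B u l ∧ C l v)

-- Multiplying by `B` turns a relation among the columns of `C` into one among the columns of `A`.
-- So the columns of `C` selected by `s` are independent too, and they live in dimension `r`.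
factorization-bound : {A : Matrix m n} → Factorization A r → IndependentColumns A k → k ≤ r
factorization-bound {A = A} (B , C , A≡BC) (s , indep) =
  independent⇒≤ (λ j l → C l (s j)) λ a comb → indep a λ u → begin
    sum (λ j → a j ∧ A u (s j))
      ≡⟨ sum-cong-≗ (λ j → trans (cong (a j ∧_) (A≡BC u (s j))) (*-distribˡ-sum (a j) (λ l → B u l ∧ C l (s j)))) ⟩
    sum (λ j → sum (λ l → a j ∧ (B u l ∧ C l (s j))))
      ≡⟨ ∑-comm (λ j l → a j ∧ (B u l ∧ C l (s j))) ⟩
    sum (λ l → sum (λ j → a j ∧ (B u l ∧ C l (s j))))
      ≡⟨ sum-zero (λ l → begin
        sum (λ j → a j ∧ (B u l ∧ C l (s j)))
          ≡⟨ sum-cong-≗ (λ j → solve 3 (λ a b c → a :* (b :* c) := b :* (a :* c)) refl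
                                 (a j) (B u l) (C l (s j))) ⟩
        sum (λ j → B u l ∧ (a j ∧ C l (s j)))
          ≡⟨ *-distribˡ-sum (B u l) (λ j → a j ∧ C l (s j)) ⟨
        B u l ∧ sum (λ j → a j ∧ C l (s j))
          ≡⟨ cong (B u l ∧_) (comb l) ⟩
        B u l ∧ false
          ≡⟨ ∧-zeroʳ (B u l) ⟩
        false ∎) ⟩
    false ∎
  where open xor-∧-Solver using (solve; _:=_; _:*_)

-- Unlike IsRank, this pair is visibly preserved by elimination steps.
HasRank : Matrix m n → ℕ → Set
HasRank A r = Factorization A r × IndependentColumns A r

hasRank⇒isRank : {A : Matrix m n} → HasRank A r → IsRank A r
hasRank⇒isRank {A = A} (factors , cols) = cols , λ k → factorization-bound {A = A} factors

-- Elimination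

-- For a pivot `A i j` equal to 1 this clears row `i` and column `j`, as in a Schur complement. Over
-- 𝔽₂ the pivot needs no inverting.
eliminate : Matrix m n → Fin m → Fin n → Matrix m n
eliminate A i j u v = A u v xor (A u j ∧ A i v)

eliminate-factorization : (A : Matrix m n) (i : Fin m) (j : Fin n) →
  Factorization (eliminate A i j) r → Factorization A (suc r)
eliminate-factorization A i j (B , C , E≡BC) =
  (λ u → A u j Vector.∷ B u) , (A i Vector.∷ C) , λ u v → begin
    A u v                                         ≡⟨ solve 2 (λ a b → a := b :+ (a :+ b)) refl (A u v) (A u j ∧ A i v) ⟩
    (A u j ∧ A i v) xor eliminate A i j u v       ≡⟨ cong ((A u j ∧ A i v) xor_) (E≡BC u v) ⟩
    (A u j ∧ A i v) xor sum (λ l → B u l ∧ C l v) ∎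
  where open xor-∧-Solver

eliminate-pivotRow : (A : Matrix m n) {i : Fin m} {j : Fin n} → A i j ≡ true →
  ∀ v → eliminate A i j i v ≡ false
eliminate-pivotRow A {i} Aij v rewrite Aij = xor-same (A i v)

-- A relation among the columns of `A` reads as `a₀ xor c` times column `j` plus a combination of
-- columns of `E`. Row `i` of `E` vanishes while `A i j` is 1, so `a₀ xor c` is 0. Independence in
-- `E` then kills `b`, hence `c`, hence `a₀`.
eliminate-independent : (A : Matrix m n) {i : Fin m} {j : Fin n} → A i j ≡ true →
  IndependentColumns (eliminate A i j) k → IndependentColumns A (suc k)
eliminate-independent A {i} {j} Aij (s , indep) = j Vector.∷ s , independent
  where
  open xor-∧-Solver using (solve; _:=_; _:*_; _:+_)

  E = eliminate A i j

  independent : LinearlyIndependent (λ l → column A ((j Vector.∷ s) l))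
  independent a comb = λ { zero → a₀≡0 ; (suc l) → b≡0 l }
    where
    a₀ = head a
    b = tail a
    c = sum (λ l → b l ∧ A i (s l))

    ∑E : Fin _ → Bool
    ∑E u = sum (λ l → b l ∧ E u (s l))

    split : ∀ u → sum (λ l → b l ∧ A u (s l)) ≡ ∑E u xor (A u j ∧ c)
    split u = begin
      sum (λ l → b l ∧ A u (s l))
        ≡⟨ sum-cong-≗ (λ l → solve 4
             (λ b a x y → b :* a := b :* (a :+ x :* y) :+ x :* (b :* y)) refl
             (b l) (A u (s l)) (A u j) (A i (s l))) ⟩
      sum (λ l → (b l ∧ E u (s l)) xor (A u j ∧ (b l ∧ A i (s l))))
        ≡⟨ ∑-distrib-+ (λ l → b l ∧ E u (s l)) (λ l → A u j ∧ (b l ∧ A i (s l))) ⟩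
      ∑E u xor sum (λ l → A u j ∧ (b l ∧ A i (s l)))
        ≡⟨ cong (∑E u xor_) (*-distribˡ-sum (A u j) (λ l → b l ∧ A i (s l))) ⟨
      ∑E u xor (A u j ∧ c) ∎

    comb′ : ∀ u → (a₀ xor c) ∧ A u j ≡ ∑E u
    comb′ u = xor≡false⇒≡ _ _ (begin
      ((a₀ xor c) ∧ A u j) xor ∑E u
        ≡⟨ solve 4 (λ a c x e → (a :+ c) :* x :+ e := a :* x :+ (e :+ x :* c)) refl a₀ c (A u j) (∑E u) ⟩
      (a₀ ∧ A u j) xor (∑E u xor (A u j ∧ c))
        ≡⟨ cong ((a₀ ∧ A u j) xor_) (split u) ⟨
      (a₀ ∧ A u j) xor sum (λ l → b l ∧ A u (s l))
        ≡⟨ comb u ⟩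
      false ∎)

    t≡0 : a₀ xor c ≡ false
    t≡0 = begin
      a₀ xor c             ≡⟨ ∧-identityʳ _ ⟨
      (a₀ xor c) ∧ true    ≡⟨ cong ((a₀ xor c) ∧_) Aij ⟨
      (a₀ xor c) ∧ A i j   ≡⟨ comb′ i ⟩
      ∑E i                 ≡⟨ sum-zero (λ l → trans (cong (b l ∧_) (eliminate-pivotRow A Aij (s l)))
                                                    (∧-zeroʳ (b l))) ⟩
      false                ∎

    b≡0 : ∀ l → b l ≡ false
    b≡0 = indep b (λ u → trans (sym (comb′ u)) (cong (_∧ A u j) t≡0))

    a₀≡0 : a₀ ≡ false
    a₀≡0 = trans (xor≡false⇒≡ _ _ t≡0) (sum-zero (λ l → cong (_∧ A i (s l)) (b≡0 l)))

eliminate-hasRank : (A : Matrix m n) {i : Fin m} {j : Fin n} → A i j ≡ true →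
  HasRank (eliminate A i j) r → HasRank A (suc r)
eliminate-hasRank A {i} {j} Aij (factors , cols) =
  eliminate-factorization A i j factors , eliminate-independent A Aij cols

eliminate-symmetric : (A : Matrix n n) (i : Fin n) → SymmetricMatrix A →
  SymmetricMatrix (eliminate A i i)
eliminate-symmetric A i symA u v = cong₂ _xor_ (symA u v) (begin
  A u i ∧ A i v ≡⟨ cong₂ _∧_ (symA u i) (symA i v) ⟩
  A i u ∧ A v i ≡⟨ ∧-comm (A i u) (A v i) ⟩
  A v i ∧ A i u ∎)

-- Sums of squares

Gram : Matrix n n → ℕ → Set
Gram {n} A k = ∃ λ (M : Fin k → Vector Bool n) → ∀ u v → A u v ≡ sum (λ l → M l u ∧ M l v)

gram-resp : {A B : Matrix n n} → (∀ u v → A u v ≡ B u v) → Gram A k → Gram B k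
gram-resp A≡B (M , A≡) = M , λ u v → trans (sym (A≡B u v)) (A≡ u v)

gram-factorization : {A : Matrix n n} → Gram A k → Factorization A k
gram-factorization (M , A≡) = (λ u l → M l u) , M , A≡

addSquare : Vector Bool n → Matrix n n → Matrix n n
addSquare w A u v = A u v xor (w u ∧ w v)

gram-addSquare : (w : Vector Bool n) {A : Matrix n n} → Gram A k → Gram (addSquare w A) (suc k)
gram-addSquare w {A} (M , A≡) = (w Vector.∷ M) , λ u v →
  trans (solve 2 (λ a b → a :+ b := b :+ a) refl (A u v) (w u ∧ w v))
        (cong ((w u ∧ w v) xor_) (A≡ u v))
  where open xor-∧-Solver

-- The outcome for a purely hyperbolic matrix. Quantifying over `w` lets a square obtained elsewhere
-- be plugged in; the zero vector covers the case where there is none.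
EvenGram : Matrix n n → ℕ → Set
EvenGram A r = Even r × (∀ w → Gram (addSquare w A) (suc r))

evenGram⇒gram : {A : Matrix n n} → EvenGram A r → Gram A (suc r)
evenGram⇒gram {A = A} (_ , gram) = gram-resp (λ u v → xor-identityʳ (A u v)) (gram (λ _ → false))

zero-hasRank : {A : Matrix m n} → (∀ u v → A u v ≡ false) → HasRank A 0
zero-hasRank {A = A} A≡0 = ((λ _ ()) , (λ ()) , A≡0) , independentColumns-0 A

zero-gram : {A : Matrix n n} → (∀ u v → A u v ≡ false) → Gram A 0
zero-gram A≡0 = (λ ()) , A≡0

-- Splitting off a hyperbolic term from an alternating matrix

module _ (A : Matrix n n) (symA : SymmetricMatrix A) (alt : ∀ u → A u u ≡ false) (i j : Fin n) where
  open xor-∧-Solver using (solve; _:=_; _:*_; _:+_)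

  eliminate₂ : Matrix n n
  eliminate₂ = eliminate (eliminate A i j) j i

  -- The first elimination changes entry `(j, i)` by the product of the diagonal entries at `j` and
  -- `i`, which is 0; by symmetry the entry is still 1.
  eliminate₂-pivot : A i j ≡ true → eliminate A i j j i ≡ true
  eliminate₂-pivot Aij rewrite symA j i | Aij | alt j = refl

  -- Each of the two eliminations breaks symmetry, but the zero diagonal removes the cross terms.
  -- Together they subtract the symmetric term built from columns `i` and `j`.
  eliminate₂-hyperbolic : ∀ u v →
    eliminate₂ u v ≡ A u v xor ((A u j ∧ A v i) xor (A u i ∧ A v j))
  eliminate₂-hyperbolic u v rewrite alt i | alt j | symA i v | symA j v =
    solve 5 (λ a x y z w → (a :+ x :* w) :+ (y :+ x :* con false) :* (z :+ con false :* w)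
                           := a :+ (x :* w :+ y :* z))
      refl (A u v) (A u j) (A u i) (A v j) (A v i)
    where open xor-∧-Solver using (con)

  eliminate₂-symmetric : SymmetricMatrix eliminate₂
  eliminate₂-symmetric u v = begin
    eliminate₂ u v                                    ≡⟨ eliminate₂-hyperbolic u v ⟩
    A u v xor ((A u j ∧ A v i) xor (A u i ∧ A v j))   ≡⟨ cong (_xor ((A u j ∧ A v i) xor (A u i ∧ A v j))) (symA u v) ⟩
    A v u xor ((A u j ∧ A v i) xor (A u i ∧ A v j))
      ≡⟨ solve 5 (λ a x y z w → a :+ (x :* w :+ y :* z) := a :+ (z :* y :+ w :* x))
           refl (A v u) (A u j) (A u i) (A v j) (A v i) ⟩
    A v u xor ((A v j ∧ A u i) xor (A v i ∧ A u j))   ≡⟨ eliminate₂-hyperbolic v u ⟨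
    eliminate₂ v u                                    ∎

  eliminate₂-alternating : ∀ u → eliminate₂ u u ≡ false
  eliminate₂-alternating u = begin
    eliminate₂ u u                                    ≡⟨ eliminate₂-hyperbolic u u ⟩
    A u u xor ((A u j ∧ A u i) xor (A u i ∧ A u j))   ≡⟨ cong (_xor ((A u j ∧ A u i) xor (A u i ∧ A u j))) (alt u) ⟩
    (A u j ∧ A u i) xor (A u i ∧ A u j)               ≡⟨ cong ((A u j ∧ A u i) xor_) (∧-comm (A u i) (A u j)) ⟩
    (A u j ∧ A u i) xor (A u j ∧ A u i)               ≡⟨ xor-same (A u j ∧ A u i) ⟩
    false                                             ∎

  eliminate₂-gram : (∀ w → Gram (addSquare w eliminate₂) k) →
    ∀ w → Gram (addSquare w A) (2 + k)
  eliminate₂-gram gram w =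
    -- With x and y the columns `i` and `j`, the induction is used at w+x instead of `w`. The
    -- squares of w+y and w+x+y then restore both the hyperbolic term and the square of `w`.
    gram-resp identity (gram-addSquare w+x+y (gram-addSquare w+y (gram w+x)))
    where
    w+x w+y w+x+y : Vector Bool n
    w+x   u = w u xor A u i
    w+y   u = w u xor A u j
    w+x+y u = w u xor (A u i xor A u j)

    identity : ∀ u v → addSquare w+x+y (addSquare w+y (addSquare w+x eliminate₂)) u v ≡ addSquare w A u v
    identity u v = trans
      (cong (λ e → ((e xor (w+x u ∧ w+x v)) xor (w+y u ∧ w+y v)) xor (w+x+y u ∧ w+x+y v))
            (eliminate₂-hyperbolic u v))
      (solve 7 (λ a w x y w′ x′ y′ →
          (((a :+ (y :* x′ :+ x :* y′)) :+ (w :+ x) :* (w′ :+ x′)) :+ (w :+ y) :* (w′ :+ y′))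
            :+ (w :+ (x :+ y)) :* (w′ :+ (x′ :+ y′))
          := a :+ w :* w′)
        refl (A u v) (w u) (A u i) (A u j) (w v) (A v i) (A v j))

-- The bound f on the numbers of independent columns drops at each elimination,
-- because eliminating a pivot costs an independent column.
alternating-evenGram : ∀ f (A : Matrix n n) → (∀ k → IndependentColumns A k → k < f) →
  SymmetricMatrix A → (∀ u → A u u ≡ false) → ∃ λ r → HasRank A r × EvenGram A r
alternating-evenGram zero    A bound symA alt = contradiction (bound 0 (independentColumns-0 A)) (λ ())
alternating-evenGram (suc f) A bound symA alt
  with any? (λ i → any? (λ j → A i j ≟ true))
-- Nothing is left but the square of `w`, which is the one vector beyond rank 0.
... | no A≢1 = 0 , zero-hasRank A≡0 , (2 ∣0) , λ w → gram-addSquare w (zero-gram A≡0)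
  where
  A≡0 : ∀ u v → A u v ≡ false
  A≡0 u v = ¬-not (λ Auv → A≢1 (u , v , Auv))
... | yes (i , j , Aij) =
  let pivot = eliminate₂-pivot A symA alt i j Aij
      -- Two pivots cost two independent columns while `f` drops only by one, so one unit is given
      -- away here.
      bound′ k cols = <-trans (n<1+n k) (s≤s⁻¹ (bound (2 + k)
        (eliminate-independent A Aij (eliminate-independent (eliminate A i j) pivot cols))))
      r , rank , even , gram = alternating-evenGram f (eliminate₂ A symA alt i j) bound′
        (eliminate₂-symmetric A symA alt i j) (eliminate₂-alternating A symA alt i j)
  in 2 + r
   , eliminate-hasRank A Aij (eliminate-hasRank (eliminate A i j) pivot rank)
   , ∣m∣n⇒∣m+n ∣-refl even
   , eliminate₂-gram A symA alt i j gram

-- Diagonal pivots keep the matrix symmetric and contribute one square each. They are used until the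
-- diagonal vanishes, and the remainder is alternating. `EvenGram` survives only if there was no
-- diagonal pivot at all.
bounded-symmetric-gram : ∀ f (A : Matrix n n) → (∀ k → IndependentColumns A k → k < f) →
  SymmetricMatrix A → ∃ λ r → HasRank A r × (Gram A r ⊎ EvenGram A r)
bounded-symmetric-gram zero    A bound symA = contradiction (bound 0 (independentColumns-0 A)) (λ ())
bounded-symmetric-gram (suc f) A bound symA with any? (λ i → A i i ≟ true)
... | no A≢1 =
  let r , rank , gram = alternating-evenGram (suc f) A bound symA (λ u → ¬-not (λ Auu → A≢1 (u , Auu)))
  in r , rank , inj₂ gram
... | yes (i , Aii) = extend (bounded-symmetric-gram f E bound′ (eliminate-symmetric A i symA))
  where
  E = eliminate A i i

  bound′ : ∀ k → IndependentColumns E k → k < f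
  bound′ k cols = s≤s⁻¹ (bound (suc k) (eliminate-independent A Aii cols))

  E+square : ∀ u v → addSquare (column A i) E u v ≡ A u v
  E+square u v = begin
    (A u v xor (A u i ∧ A i v)) xor (A u i ∧ A v i)
      ≡⟨ cong (λ e → (A u v xor (A u i ∧ A i v)) xor (A u i ∧ e)) (symA v i) ⟩
    (A u v xor (A u i ∧ A i v)) xor (A u i ∧ A i v)
      ≡⟨ solve 2 (λ a b → (a :+ b) :+ b := a) refl (A u v) (A u i ∧ A i v) ⟩
    A u v ∎
    where open xor-∧-Solver

  extend : (∃ λ r → HasRank E r × (Gram E r ⊎ EvenGram E r)) →
           ∃ λ r → HasRank A r × (Gram A r ⊎ EvenGram A r)
  extend (r , rank , inj₁ gram) = suc r , eliminate-hasRank A Aii rank ,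
    inj₁ (gram-resp E+square (gram-addSquare (column A i) gram))
  -- The square of the pivot column serves as `w` and absorbs every hyperbolic term, so the number
  -- of squares equals the rank.
  extend (r , rank , inj₂ (_ , gram)) = suc r , eliminate-hasRank A Aii rank ,
    inj₁ (gram-resp E+square (gram (column A i)))

symmetric-gram : (A : Matrix n n) → SymmetricMatrix A →
  ∃ λ r → IsRank A r × (Gram A r ⊎ EvenGram A r)
symmetric-gram {n} A symA =
  -- At most `n` columns are independent in 𝔽₂ⁿ, so `suc n` is a strict bound.
  let r , rank , gram = bounded-symmetric-gram (suc n) A
        (λ k (s , indep) → s≤s (independent⇒≤ (λ j → column A (s j)) indep)) symA
  in r , hasRank⇒isRank rank , gram

isRank⇒gram : (A : Matrix n n) → SymmetricMatrix A → IsRank A r → Gram A r ⊎ EvenGram A r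
isRank⇒gram A symA rank with symmetric-gram A symA
... | _ , rank′ , gram with refl ← isRank-unique {A = A} rank′ rank = gram

-- Subgraph complementation systems as Gram matrices

-- Reduction of ℕ modulo 2 into 𝔽₂: `not` adds 1, so a count becomes a sum in the field.
isOdd : ℕ → Bool
isOdd zero    = false
isOdd (suc n) = not (isOdd n)

even⇔ : ∀ n → Even n ⇔ isOdd n ≡ false
even⇔ n = mk⇔ (λ { (divides-refl q) → to q }) (from n)
  where
  to : ∀ q → isOdd (q * 2) ≡ false
  to zero    = refl
  to (suc q) = trans (not-involutive _) (to q)

  from : ∀ n → isOdd n ≡ false → 2 ∣ n
  from zero          _  = 2 ∣0
  from (suc (suc n)) eq = ∣m∣n⇒∣m+n ∣-refl (from n (trans (sym (not-involutive _)) eq))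

isOdd-count : ∀ {A : Set} {P : Pred A 0ℓ} (P? : Decidable P) (xs : Vec A k) →
  isOdd (count P? xs) ≡ sum (λ l → does (P? (lookup xs l)))
isOdd-count P? []       = refl
isOdd-count P? (x ∷ xs) with does (P? x)
... | true  = cong not (isOdd-count P? xs)
... | false = isOdd-count P? xs

does-∈? : ∀ (u : Fin n) S → does (u ∈? S) ≡ lookup S u
does-∈? zero    (true  ∷ S) = refl
does-∈? zero    (false ∷ S) = refl
does-∈? (suc u) (_     ∷ S) = does-∈? u S

-- This is M Mᵀ for the incidence matrix M of the family, whose columns are the sets; an entry is
-- the parity of the number of sets containing both vertices.
gramMatrix : Vec (Subset n) k → Matrix n n
gramMatrix 𝒞 u v = sum (λ l → lookup (lookup 𝒞 l) u ∧ lookup (lookup 𝒞 l) v)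

¬-cong-⇔ : {P Q : Set} → P ⇔ Q → (¬ P) ⇔ (¬ Q)
¬-cong-⇔ P⇔Q = mk⇔ (_∘ from) (_∘ to)
  where open Equivalence P⇔Q

odd-count⇔ : ∀ (𝒞 : Vec (Subset n) k) u v →
  Odd (count (λ S → (u ∈? S) ×-dec (v ∈? S)) 𝒞) ⇔ (¬ gramMatrix 𝒞 u v ≡ false)
odd-count⇔ 𝒞 u v = ¬-cong-⇔
  (subst (λ b → Even (count P? 𝒞) ⇔ b ≡ false)
    (trans (isOdd-count P? 𝒞)
      (sum-cong-≗ (λ l → cong₂ _∧_ (does-∈? u (lookup 𝒞 l)) (does-∈? v (lookup 𝒞 l)))))
    (even⇔ (count P? 𝒞)))
  where P? = λ S → (u ∈? S) ×-dec (v ∈? S)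

system⇔fits : (G : Graph n) (𝒞 : Vec (Subset n) k) →
  IsSubgraphComplementationSystem G 𝒞 ⇔ Fits (gramMatrix 𝒞) G
system⇔fits G 𝒞 = mk⇔
  (λ system u v u≢v → ⇔-sym (system u v u≢v) ⇔-∘ ⇔-sym (odd-count⇔ 𝒞 u v))
  (λ fits u v u≢v → ⇔-sym (odd-count⇔ 𝒞 u v) ⇔-∘ ⇔-sym (fits u v u≢v))

fits-resp : (G : Graph n) {A B : Matrix n n} → (∀ u v → A u v ≡ B u v) → Fits A G → Fits B G
fits-resp G A≡B fits u v u≢v = subst (λ b → (¬ b ≡ false) ⇔ u ~ v) (A≡B u v) (fits u v u≢v)
  where open Graph G

gram-fits⇒system : (G : Graph n) {A : Matrix n n} → Fits A G → Gram A k →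
  ∃ λ (𝒞 : Vec (Subset n) k) → IsSubgraphComplementationSystem G 𝒞
gram-fits⇒system {n} {k} G {A} fits (M , A≡) = 𝒞 , Equivalence.from (system⇔fits G 𝒞) (fits-resp G A≡gram fits)
  where
  𝒞 : Vec (Subset n) k
  𝒞 = tabulate (λ l → tabulate (M l))

  lookup-𝒞 : ∀ l u → M l u ≡ lookup (lookup 𝒞 l) u
  lookup-𝒞 l u = sym (trans (cong (λ S → lookup S u) (lookup∘tabulate _ l)) (lookup∘tabulate (M l) u))

  A≡gram : ∀ u v → A u v ≡ gramMatrix 𝒞 u v
  A≡gram u v = trans (A≡ u v) (sum-cong-≗ (λ l → cong₂ _∧_ (lookup-𝒞 l u) (lookup-𝒞 l v)))

-- Existence of the two minima

-- The given witness bounds the search, and decidability settles each smaller number.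
minimum : {P : Pred ℕ 0ℓ} → Decidable P → ∀ k → P k → ∃ (IsMinimum P)
minimum P? zero    P0 = 0 , P0 , λ _ _ → z≤n
minimum P? (suc k) Pk with P? 0
... | yes P0 = 0 , P0 , λ _ _ → z≤n
... | no ¬P0 =
  let m , Pm , m≤ = minimum (P? ∘ suc) k Pk
  in suc m , Pm , λ { zero P0 → contradiction P0 ¬P0 ; (suc j) Pj → s≤s (m≤ j Pj) }

_⇔-dec_ : {P Q : Set} → Dec P → Dec Q → Dec (P ⇔ Q)
P? ⇔-dec Q? = map′ (uncurry mk⇔) (λ e → Equivalence.to e , Equivalence.from e)
  ((P? →-dec Q?) ×-dec (Q? →-dec P?))

fits? : (A : Matrix n n) (G : Graph n) → Dec (Fits A G)
fits? A G = all? λ u → all? λ v → ¬? (u Fin.≟ v) →-dec (¬? (A u v ≟ false) ⇔-dec (u ~? v))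
  where open Graph G

symmetric? : (A : Matrix n n) → Dec (SymmetricMatrix A)
symmetric? A = all? λ u → all? λ v → A u v ≟ A v u

anyFamily? : {P : Pred (Vec (Subset n) k) 0ℓ} → Decidable P → Dec (∃ P)
anyFamily? {k = zero}  P? = map′ (λ P[] → [] , P[]) (λ { ([] , P[]) → P[] }) (P? [])
anyFamily? {k = suc k} P? =
  map′ (λ (S , 𝒞 , PS𝒞) → S ∷ 𝒞 , PS𝒞) (λ { (S ∷ 𝒞 , PS𝒞) → S , 𝒞 , PS𝒞 })
       (anySubset? (λ S → anyFamily? (λ 𝒞 → P? (S ∷ 𝒞))))

-- A family of subsets doubles as the list of rows of a matrix over 𝔽₂, so the search is finite.
-- Matrices are functions and agree with their tabulation only pointwise, hence `resp`.
anyMatrix? : {P : Pred (Matrix m n) 0ℓ} → (∀ {A B} → (∀ u v → A u v ≡ B u v) → P A → P B) →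
  Decidable P → Dec (∃ P)
anyMatrix? resp P? = map′
  (λ (rows , Prows) → _ , Prows)
  (λ (A , PA) → tabulate (λ u → tabulate (A u)) , resp
    (λ u v → sym (trans (cong (λ S → lookup S v) (lookup∘tabulate _ u)) (lookup∘tabulate (A u) v))) PA)
  (anyFamily? (λ rows → P? (λ u v → lookup (lookup rows u) v)))

hasSystem? : (G : Graph n) → Decidable (λ k → ∃ λ (𝒞 : Vec (Subset n) k) → IsSubgraphComplementationSystem G 𝒞)
hasSystem? G k = anyFamily? λ 𝒞 →
  map′ (Equivalence.from (system⇔fits G 𝒞)) (Equivalence.to (system⇔fits G 𝒞)) (fits? (gramMatrix 𝒞) G)

FittingRank : Graph n → Pred ℕ 0ℓ
FittingRank {n} G r = ∃ λ (A : Matrix n n) → SymmetricMatrix A × Fits A G × IsRank A r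

fittingRank? : (G : Graph n) → Decidable (FittingRank G)
fittingRank? {n} G r = anyMatrix? resp dec
  where
  P : Pred (Matrix n n) 0ℓ
  P A = SymmetricMatrix A × Fits A G × IsRank A r

  resp : ∀ {A B} → (∀ u v → A u v ≡ B u v) → P A → P B
  resp A≡B (symA , fits , rank) =
    (λ u v → trans (sym (A≡B u v)) (trans (symA u v) (A≡B v u))) ,
    fits-resp G A≡B fits , isRank-resp A≡B rank

  dec : Decidable P
  dec A with symmetric? A
  ... | no ¬symA = no (¬symA ∘ proj₁)
  ... | yes symA =
    -- Rather than testing the definition of rank, compute the rank by elimination and compare it
    -- with `r`.
    let r′ , rank′ , _ = symmetric-gram A symA
    in map′ (λ (fits , r≡) → symA , fits , subst (IsRank A) r≡ rank′)
            (λ (_ , fits , rank) → fits , isRank-unique {A = A} rank′ rank)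
            (fits? A G ×-dec (r′ ℕ.≟ r))

adjacency : Graph n → Matrix n n
adjacency G u v = does (u ~? v)
  where open Graph G

adjacency-symmetric : (G : Graph n) → SymmetricMatrix (adjacency G)
adjacency-symmetric G u v = does-⇔ (mk⇔ ~-sym ~-sym) (u ~? v) (v ~? u)
  where open Graph G

adjacency-fits : (G : Graph n) → Fits (adjacency G) G
adjacency-fits G u v _ = mk⇔
  (λ ≢0 → decidable-stable (u ~? v) (≢0 ∘ dec-false (u ~? v)))
  (λ u~v ≡0 → contradiction (trans (sym (dec-true (u ~? v) u~v)) ≡0) (λ ()))
  where open Graph G

-- Comparing the two numbers

gramMatrix-symmetric : (𝒞 : Vec (Subset n) k) → SymmetricMatrix (gramMatrix 𝒞)
gramMatrix-symmetric 𝒞 u v = sum-cong-≗ (λ l → ∧-comm (lookup (lookup 𝒞 l) u) (lookup (lookup 𝒞 l) v))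

-- The incidence matrix factors the fitting matrix through dimension `k`, which bounds its rank by
-- the size of the system.
system⇒fittingRank : (G : Graph n) (𝒞 : Vec (Subset n) k) → IsSubgraphComplementationSystem G 𝒞 →
  ∃ λ r → FittingRank G r × r ≤ k
system⇒fittingRank G 𝒞 system =
  let r , rank , _ = symmetric-gram (gramMatrix 𝒞) (gramMatrix-symmetric 𝒞)
  in r , (gramMatrix 𝒞 , gramMatrix-symmetric 𝒞 , Equivalence.to (system⇔fits G 𝒞) system , rank) ,
     factorization-bound {A = gramMatrix 𝒞} (gram-factorization ((λ l → lookup (lookup 𝒞 l)) , λ _ _ → refl)) (proj₁ rank)

mr≤c₂ : ∀ (G : Graph n) {c₂ mr} → IsSubgraphComplementationNumber G c₂ → IsMinimumRank G 𝔽₂ mr → mr ≤ c₂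
mr≤c₂ G ((𝒞 , system) , _) (_ , mr≤) =
  let r , fitting , r≤c₂ = system⇒fittingRank G 𝒞 system
  in ≤-trans (mr≤ r fitting) r≤c₂

c₂-mr-dichotomy : ∀ (G : Graph n) {c₂ mr} → IsSubgraphComplementationNumber G c₂ → IsMinimumRank G 𝔽₂ mr →
  c₂ ≡ mr ⊎ (c₂ ≡ suc mr × Even mr)
c₂-mr-dichotomy G {c₂} {mr} isMin-c₂@(_ , c₂≤) isMin-mr@((A , symA , fits , rank) , _) =
  dichotomy (isRank⇒gram A symA rank)
  where
  lower : mr ≤ c₂
  lower = mr≤c₂ G {c₂} {mr} isMin-c₂ isMin-mr

  upper : ∀ {k} → Gram A k → c₂ ≤ k
  upper gram = c₂≤ _ (gram-fits⇒system G fits gram)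

  dichotomy : Gram A mr ⊎ EvenGram A mr → c₂ ≡ mr ⊎ (c₂ ≡ suc mr × Even mr)
  dichotomy (inj₁ gram) = inj₁ (≤-antisym (upper gram) lower)
  -- Here `c₂` lies between `mr` and `suc mr`. Equality with `mr` remains possible, since another
  -- matrix of the same rank may have a nonzero diagonal.
  dichotomy (inj₂ evenGram) =
    [ (λ mr<c₂ → inj₂ (≤-antisym (upper (evenGram⇒gram {A = A} evenGram)) mr<c₂ , proj₁ evenGram))
    , (λ mr≡c₂ → inj₁ (sym mr≡c₂))
    ]′ (m≤n⇒m<n∨m≡n lower)

-- Existence of both numbers, with the adjacency matrix as witness

mr-exists : (G : Graph n) → ∃ (IsMinimumRank G 𝔽₂)
mr-exists G =
  let r , rank , _ = symmetric-gram (adjacency G) (adjacency-symmetric G)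
  in minimum (fittingRank? G) r (adjacency G , adjacency-symmetric G , adjacency-fits G , rank)

c₂-exists : (G : Graph n) → ∃ (IsSubgraphComplementationNumber G)
c₂-exists {n} G =
  let _ , _ , gram = symmetric-gram (adjacency G) (adjacency-symmetric G)
      k , systemₖ = system gram
  in minimum (hasSystem? G) k systemₖ
  where
  system : ∀ {r} → Gram (adjacency G) r ⊎ EvenGram (adjacency G) r →
    ∃ λ k → ∃ λ (𝒞 : Vec (Subset n) k) → IsSubgraphComplementationSystem G 𝒞
  system (inj₁ gram)     = _ , gram-fits⇒system G (adjacency-fits G) gram
  system (inj₂ evenGram) = _ , gram-fits⇒system G (adjacency-fits G) (evenGram⇒gram {A = adjacency G} evenGram)

corollary4p7 : ∀ (n : ℕ) (G : Graph n) →
    ∃ λ (c₂ : ℕ) → ∃ λ (mr : ℕ) →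
    IsSubgraphComplementationNumber G c₂ ×
    IsMinimumRank G 𝔽₂ mr ×
    (c₂ ≡ mr ⊎ (c₂ ≡ suc mr × Even mr))
corollary4p7 n G =
  let c₂ , isMin-c₂ = c₂-exists G
      mr , isMin-mr = mr-exists G
  in c₂ , mr , isMin-c₂ , isMin-mr , c₂-mr-dichotomy G isMin-c₂ isMin-mr
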